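{- Every connected locally connected $\{K_{1,1,3},K_1+(K_1\cup P_3)\}$-free graph of order at least $3$ is fully cycle extendable.
   Context: All graphs are finite, simple, and undirected. $n(G)$ is the order of $G$; $N_G(u)$ is the (open) neighborhood of $u$ in $G$. $G$ is locally connected if for every vertex $u$ of $G$ the induced subgraph $G[N_G(u)]$ is connected. For disjoint graphs $G,H$, $G\cup H$ is their disjoint union and $G+H$ their join (all edges between $G$ and $H$ are added to $G\cup H$); $K_n$ and $P_n$ are the complete graph and the path of order $n$, $\bar{G}$ is the complement of $G$, and $K_{1,1,3}=K_1+K_1+\bar{K}_3$. For a set ${\cal F}$ of graphs, a graph is ${\cal F}$-free if it contains no graph in ${\cal F}$ as an induced subgraph (up to isomorphism). A cycle $C$ in $G$ is extendable if $G$ contains a cycle $C'$ of order $n(C)+1$ with $V(C)\subseteq V(C')$. $G$ is fully cycle extendable if every vertex of $G$ lies on a triangle and every cycle in $G$ of order less than $n(G)$ is extendable. -}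

module Defs where

open import Data.Bool.Base using (Bool; true; false; not; _∧_; _∨_; T)
open import Data.Bool.Properties using (∨-comm)
open import Data.Fin.Base using (Fin; toℕ)
open import Data.Fin.Properties using (_≟_)
open import Data.List.Base using (List; []; _∷_; _∷ʳ_; length)
open import Data.List.Membership.Propositional using (_∈_)
open import Data.List.Relation.Binary.Subset.Propositional using (_⊆_)
open import Data.List.Relation.Unary.All using (All)
open import Data.List.Relation.Unary.Linked using (Linked)
open import Data.List.Relation.Unary.Unique.Propositional using (Unique)
open import Data.Nat.Base using (ℕ; zero; suc; _≤_; _<_; _≡ᵇ_)
open import Data.Product.Base using (Σ; ∃; ∃-syntax; _×_; _,_)
open import Data.Sum.Base using (_⊎_; inj₁; inj₂)
open import Function.Base using (_∘_)
open import Function.Bundles using (_↔_; Inverse; mk⇔)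
open import Relation.Binary.Construct.Closure.ReflexiveTransitive using (Star)
open import Relation.Binary.PropositionalEquality using (_≡_; refl; sym; cong; cong₂)
open import Relation.Nullary using (¬_; does)
open import Relation.Nullary.Decidable using (does-⇔; dec-true)

private
  variable
    V W : Set
    n : ℕ

-- Simple undirected graphs on the vertex type V.  Adjacency is Boolean, hence
-- decidable and proof-irrelevant; the latter makes `Σ V (T ∘ S)` below have
-- exactly one vertex for each element of S.  A finite graph of order n is a
-- `Graph (Fin n)`.
record Graph (V : Set) : Set where
  field
    adj        : V → V → Bool
    adj-sym    : ∀ u v → adj u v ≡ adj v u
    adj-irrefl : ∀ v → adj v v ≡ false

  Adj : V → V → Set
  Adj u v = T (adj u v)

open Graph public

order : Graph (Fin n) → ℕ
order {n} _ = n

neighborhood : Graph V → V → (V → Bool)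
neighborhood G u = adj G u

_[_] : Graph V → (S : V → Bool) → Graph (Σ V (T ∘ S))
adj        (G [ S ]) (u , _) (v , _) = adj G u v
adj-sym    (G [ S ]) (u , _) (v , _) = adj-sym G u v
adj-irrefl (G [ S ]) (v , _)         = adj-irrefl G v

-- The graph without vertices counts as connected.  This convention is
-- immaterial for connected graphs of order at least 2, since there every
-- neighborhood is nonempty.
Connected : Graph V → Set
Connected G = ∀ u v → Star (Adj G) u v

LocallyConnected : Graph V → Set
LocallyConnected G = ∀ u → Connected (G [ neighborhood G u ])

K : ∀ n → Graph (Fin n)
adj        (K n) i j = not (does (i ≟ j))
adj-sym    (K n) i j = cong not (does-⇔ (mk⇔ sym sym) (i ≟ j) (j ≟ i))
adj-irrefl (K n) i   = cong not (dec-true (i ≟ i) refl)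

private
  suc≢ᵇ : ∀ m → (suc m ≡ᵇ m) ≡ false
  suc≢ᵇ zero    = refl
  suc≢ᵇ (suc m) = suc≢ᵇ m

P : ∀ n → Graph (Fin n)
adj        (P n) i j = (suc (toℕ i) ≡ᵇ toℕ j) ∨ (suc (toℕ j) ≡ᵇ toℕ i)
adj-sym    (P n) i j = ∨-comm (suc (toℕ i) ≡ᵇ toℕ j) (suc (toℕ j) ≡ᵇ toℕ i)
adj-irrefl (P n) i   = cong₂ _∨_ (suc≢ᵇ (toℕ i)) (suc≢ᵇ (toℕ i))

complement : Graph (Fin n) → Graph (Fin n)
adj        (complement G) i j = adj (K _) i j ∧ not (adj G i j)
adj-sym    (complement G) i j = cong₂ _∧_ (adj-sym (K _) i j) (cong not (adj-sym G i j))
adj-irrefl (complement G) i   = cong (_∧ not (adj G i i)) (adj-irrefl (K _) i)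

infixr 6 _∪_ _+_

_∪_ : Graph V → Graph W → Graph (V ⊎ W)
adj        (G ∪ H) (inj₁ u) (inj₁ v) = adj G u v
adj        (G ∪ H) (inj₂ u) (inj₂ v) = adj H u v
adj        (G ∪ H) (inj₁ _) (inj₂ _) = false
adj        (G ∪ H) (inj₂ _) (inj₁ _) = false
adj-sym    (G ∪ H) (inj₁ u) (inj₁ v) = adj-sym G u v
adj-sym    (G ∪ H) (inj₂ u) (inj₂ v) = adj-sym H u v
adj-sym    (G ∪ H) (inj₁ _) (inj₂ _) = refl
adj-sym    (G ∪ H) (inj₂ _) (inj₁ _) = refl
adj-irrefl (G ∪ H) (inj₁ v)          = adj-irrefl G v
adj-irrefl (G ∪ H) (inj₂ v)          = adj-irrefl H v

_+_ : Graph V → Graph W → Graph (V ⊎ W)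
adj        (G + H) (inj₁ u) (inj₁ v) = adj G u v
adj        (G + H) (inj₂ u) (inj₂ v) = adj H u v
adj        (G + H) (inj₁ _) (inj₂ _) = true
adj        (G + H) (inj₂ _) (inj₁ _) = true
adj-sym    (G + H) (inj₁ u) (inj₁ v) = adj-sym G u v
adj-sym    (G + H) (inj₂ u) (inj₂ v) = adj-sym H u v
adj-sym    (G + H) (inj₁ _) (inj₂ _) = refl
adj-sym    (G + H) (inj₂ _) (inj₁ _) = refl
adj-irrefl (G + H) (inj₁ v)          = adj-irrefl G v
adj-irrefl (G + H) (inj₂ v)          = adj-irrefl H v

K₁,₁,₃ : Graph (Fin 1 ⊎ Fin 1 ⊎ Fin 3)
K₁,₁,₃ = K 1 + K 1 + complement (K 3)

_≅_ : Graph V → Graph W → Set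
_≅_ {V} {W} G H =
  Σ (V ↔ W) λ φ → ∀ u v → adj G u v ≡ adj H (Inverse.to φ u) (Inverse.to φ v)

_InducedSubgraphOf_ : Graph W → Graph V → Set
H InducedSubgraphOf G = ∃[ S ] H ≅ (G [ S ])

-- The members of 𝓕 may have different vertex types.
_-Free_ : List (∃ Graph) → Graph V → Set₁
𝓕 -Free G = All (λ (_ , H) → ¬ (H InducedSubgraphOf G)) 𝓕

-- A cycle v₁ v₂ … vₖ v₁, given by its distinct vertices in cyclic order from
-- a chosen start v₁, with k ≥ 3.
record Cycle (G : Graph V) : Set where
  field
    start : V
    rest  : List V

  vertices : List V
  vertices = start ∷ rest

  field
    distinct : Unique vertices
    length≥3 : 3 ≤ length vertices
    closed   : Linked (Adj G) (vertices ∷ʳ start)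

open Cycle public using (vertices)

cycleOrder : {G : Graph V} → Cycle G → ℕ
cycleOrder C = length (vertices C)

Extendable : {G : Graph V} → Cycle G → Set
Extendable {G = G} C =
  Σ (Cycle G) λ C′ → cycleOrder C′ ≡ suc (cycleOrder C) × vertices C ⊆ vertices C′

OnTriangle : (G : Graph V) → V → Set
OnTriangle G u = Σ (Cycle G) λ C → cycleOrder C ≡ 3 × u ∈ vertices C

FullyCycleExtendable : Graph (Fin n) → Set
FullyCycleExtendable G =
  (∀ u → OnTriangle G u) × (∀ (C : Cycle G) → cycleOrder C < order G → Extendable C)

{-# OPTIONS --safe #-}

-- A graph is free of the two forbidden graphs exactly when no neighborhood N(x)
-- contains an induced claw or an induced K₁ ∪ P₃.  A connected N(x) then has no
-- independent triple: given such a triple p, b, c, no neighbor q of p in N(x)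
-- meets b or c, so q, b, c is again such a triple, and walking from p to b inside
-- N(x) is contradictory.  Hence G is claw-free, and Hendry's argument for locally
-- connected claw-free graphs applies.  Let x on the cycle have a neighbor off the
-- cycle.  A walk in N(x) from there to the successor of x makes the cycle
-- extendable, or it yields a chord xz with a common neighbor y of x and z off the
-- cycle, and a common neighbor w of x and z on the cycle which is not adjacent to
-- y.  In the latter case claw-freeness passes these properties of w on to its
-- successor, until w is a cycle neighbor of x or z, and then the cycle can be
-- extended.
module Submission where

open import Defs
import Algebra.Solver.CommutativeMonoid as CommutativeMonoidSolver
open import Data.Bool.Base using (Bool; true; false; T)
open import Data.Bool.Properties using (T?; T-irrelevant)
open import Data.Empty using (⊥-elim)
open import Data.Fin.Base using (Fin; zero; suc)
open import Data.Fin.Properties using (_≟_; any?; injective⇒≤; ¬∀⟶∃¬)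
open import Data.List.Base using (List; []; _∷_; _++_; _∷ʳ_; length; reverse)
open import Data.List.Membership.Propositional using (_∈_; _∉_)
open import Data.List.Membership.Propositional.Properties using (∈-++⁺ˡ; ∈-++⁺ʳ; ∈-++⁻)
open import Data.List.Membership.Setoid.Properties using (index-injective)
import Data.List.Membership.DecPropositional as DecMembership
open import Data.List.Properties using (++-assoc; unfold-reverse)
open import Data.List.Relation.Binary.Permutation.Propositional
  using (_↭_; prep; swap; ↭-refl; ↭-sym; ↭-trans; ↭-reflexive; ↭⇒↭ₛ)
open import Data.List.Relation.Binary.Permutation.Propositional.Properties
  using (↭-length; ∈-resp-↭; ↭-reverse; ++-comm; ++⁺; ++⁺ʳ; ++-commutativeMonoid; ∷↭∷ʳ)
open import Data.List.Relation.Binary.Permutation.Setoid.Properties using (Unique-resp-↭)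
open import Data.List.Relation.Unary.All as All using ([]; _∷_)
open import Data.List.Relation.Unary.AllPairs using ([]; _∷_)
open import Data.List.Relation.Unary.Any using (here; there; index)
open import Data.List.Relation.Unary.Linked using (Linked; [-]; _∷_)
open import Data.List.Relation.Unary.Unique.Propositional using (Unique)
open import Data.Nat.Base using (ℕ; _≤_; _<_; z≤n; s≤s)
open import Data.Nat.Properties using (≤-trans; ≤-refl; <⇒≱; m≤n⇒m≤1+n)
open import Data.Product.Base using (Σ; ∃-syntax; _×_; _,_; proj₁; proj₂)
open import Data.Sum.Base using (_⊎_; inj₁; inj₂; [_,_]′)
open import Function.Base using (_∘_; const)
open import Function.Bundles using (mk↔ₛ′)
open import Function.Definitions using (Injective)
open import Relation.Binary.Construct.Closure.ReflexiveTransitive using (Star; ε; _◅_)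
open import Relation.Binary.PropositionalEquality
  using (_≡_; _≢_; refl; sym; trans; cong; subst; setoid)
open import Relation.Nullary using (¬_; Dec; yes; no)
open import Relation.Nullary.Decidable using (⌊_⌋; toWitness; fromWitness; map′; _⊎-dec_)

private
  variable
    V W : Set
    n : ℕ

Adj-sym : (G : Graph V) {u v : V} → Adj G u v → Adj G v u
Adj-sym G {u} {v} = subst T (adj-sym G u v)

Adj⇒≢ : (G : Graph V) {u v : V} → Adj G u v → u ≢ v
Adj⇒≢ G {u} u~u refl = subst T (adj-irrefl G u) u~u

T⇒true≡ : ∀ {b} → T b → true ≡ b
T⇒true≡ {true} _ = refl

¬T⇒false≡ : ∀ {b} → ¬ T b → false ≡ b
¬T⇒false≡ {false} _  = refl
¬T⇒false≡ {true}  ¬t = ⊥-elim (¬t _)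

-- Induced subgraphs

module _ {H : Graph W} {G : Graph V} where

  -- The vertex set of an induced subgraph is a Boolean predicate, so the image of `f` must be
  -- decidable; `from` reads the preimage off the witness of that decision.
  embedding⇒induced :
    (f : W → V) → (∀ v → Dec (∃[ w ] f w ≡ v)) → Injective _≡_ _≡_ f →
    (∀ u v → adj H u v ≡ adj G (f u) (f v)) → H InducedSubgraphOf G
  embedding⇒induced f image? f-injective f-adj =
    S , mk↔ₛ′ to from to∘from from∘to , f-adj
    where
    S : V → Bool
    S v = ⌊ image? v ⌋

    to : W → Σ V (T ∘ S)
    to w = f w , fromWitness {a? = image? (f w)} (w , refl)

    from : Σ V (T ∘ S) → W
    from (v , v∈S) = proj₁ (toWitness {a? = image? v} v∈S)

    Σ-≡ : {u v : V} {s : T (S u)} {t : T (S v)} → u ≡ v → (u , s) ≡ (v , t)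
    Σ-≡ {u} refl = cong (u ,_) (T-irrelevant _ _)

    to∘from : ∀ p → to (from p) ≡ p
    to∘from (v , v∈S) = Σ-≡ (proj₂ (toWitness {a? = image? v} v∈S))

    from∘to : ∀ w → from (to w) ≡ w
    from∘to w = f-injective
      (proj₂ (toWitness {a? = image? (f w)} (fromWitness {a? = image? (f w)} (w , refl))))

three : V → V → V → Fin 3 → V
three a b c zero             = a
three a b c (suc zero)       = b
three a b c (suc (suc zero)) = c

three-all : (Q : V → Set) {a b c : V} → Q a → Q b → Q c → ∀ i → Q (three a b c i)
three-all Q qa qb qc zero             = qa
three-all Q qa qb qc (suc zero)       = qb
three-all Q qa qb qc (suc (suc zero)) = qc

three-injective : {a b c : V} → a ≢ b → a ≢ c → b ≢ c → Injective _≡_ _≡_ (three a b c)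
three-injective ab ac bc {zero}           {zero}           _ = refl
three-injective ab ac bc {zero}           {suc zero}       e = ⊥-elim (ab e)
three-injective ab ac bc {zero}           {suc (suc zero)} e = ⊥-elim (ac e)
three-injective ab ac bc {suc zero}       {zero}           e = ⊥-elim (ab (sym e))
three-injective ab ac bc {suc zero}       {suc zero}       _ = refl
three-injective ab ac bc {suc zero}       {suc (suc zero)} e = ⊥-elim (bc e)
three-injective ab ac bc {suc (suc zero)} {zero}           e = ⊥-elim (ac (sym e))
three-injective ab ac bc {suc (suc zero)} {suc zero}       e = ⊥-elim (bc (sym e))
three-injective ab ac bc {suc (suc zero)} {suc (suc zero)} _ = refl

module _ (H : Graph (Fin 3)) (G : Graph V) {a b c : V}
  (ab : adj H zero (suc zero) ≡ adj G a b)
  (ac : adj H zero (suc (suc zero)) ≡ adj G a c)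
  (bc : adj H (suc zero) (suc (suc zero)) ≡ adj G b c) where

  private
    flip-adj : ∀ {i j u v} → adj H i j ≡ adj G u v → adj H j i ≡ adj G v u
    flip-adj e = trans (adj-sym H _ _) (trans e (adj-sym G _ _))

    loop : ∀ {i v} → adj H i i ≡ adj G v v
    loop = trans (adj-irrefl H _) (sym (adj-irrefl G _))

  three-adj : ∀ i j → adj H i j ≡ adj G (three a b c i) (three a b c j)
  three-adj zero             zero             = loop
  three-adj zero             (suc zero)       = ab
  three-adj zero             (suc (suc zero)) = ac
  three-adj (suc zero)       zero             = flip-adj ab
  three-adj (suc zero)       (suc zero)       = loop
  three-adj (suc zero)       (suc (suc zero)) = bc
  three-adj (suc (suc zero)) zero             = flip-adj ac
  three-adj (suc (suc zero)) (suc zero)       = flip-adj bc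
  three-adj (suc (suc zero)) (suc (suc zero)) = loop

module _ (G : Graph (Fin n)) (J : Graph (Fin 1 ⊎ Fin 3)) where

  -- Both forbidden graphs are `K 1 + J` with `J` on one vertex plus three, so one embedding serves
  -- both: `x` is the apex, `y` the lone vertex of `J`.
  cone-induced : ∀ {x y} {t : Fin 3 → Fin n} →
    Adj G x y → (∀ i → Adj G x (t i)) → (∀ i → y ≢ t i) → Injective _≡_ _≡_ t →
    (∀ i → adj J (inj₁ zero) (inj₂ i) ≡ adj G y (t i)) →
    (∀ i j → adj J (inj₂ i) (inj₂ j) ≡ adj G (t i) (t j)) →
    (K 1 + J) InducedSubgraphOf G
  cone-induced {x} {y} {t} x~y x~t y≢t t-injective yt tt =
    embedding⇒induced {H = K 1 + J} {G} f image? f-injective f-adj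
    where
    f : Fin 1 ⊎ Fin 1 ⊎ Fin 3 → Fin n
    f = [ const x , [ const y , t ]′ ]′

    image? : ∀ v → Dec (∃[ w ] f w ≡ v)
    image? v = map′
      [ (λ e → inj₁ zero , e) , [ (λ e → inj₂ (inj₁ zero) , e) , (λ (i , e) → inj₂ (inj₂ i) , e) ]′ ]′
      (λ { (inj₁ _ , e) → inj₁ e ; (inj₂ (inj₁ _) , e) → inj₂ (inj₁ e)
         ; (inj₂ (inj₂ i) , e) → inj₂ (inj₂ (i , e)) })
      ((x ≟ v) ⊎-dec ((y ≟ v) ⊎-dec any? (λ i → t i ≟ v)))

    f-injective : Injective _≡_ _≡_ f
    f-injective {inj₁ zero}        {inj₁ zero}        _ = refl
    f-injective {inj₁ zero}        {inj₂ (inj₁ zero)} e = ⊥-elim (Adj⇒≢ G x~y e)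
    f-injective {inj₁ zero}        {inj₂ (inj₂ i)}    e = ⊥-elim (Adj⇒≢ G (x~t i) e)
    f-injective {inj₂ (inj₁ zero)} {inj₁ zero}        e = ⊥-elim (Adj⇒≢ G x~y (sym e))
    f-injective {inj₂ (inj₁ zero)} {inj₂ (inj₁ zero)} _ = refl
    f-injective {inj₂ (inj₁ zero)} {inj₂ (inj₂ i)}    e = ⊥-elim (y≢t i e)
    f-injective {inj₂ (inj₂ i)}    {inj₁ zero}        e = ⊥-elim (Adj⇒≢ G (x~t i) (sym e))
    f-injective {inj₂ (inj₂ i)}    {inj₂ (inj₁ zero)} e = ⊥-elim (y≢t i (sym e))
    f-injective {inj₂ (inj₂ i)}    {inj₂ (inj₂ j)}    e = cong (inj₂ ∘ inj₂) (t-injective e)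

    f-adj : ∀ u v → adj (K 1 + J) u v ≡ adj G (f u) (f v)
    f-adj (inj₁ zero)        (inj₁ zero)        = sym (adj-irrefl G x)
    f-adj (inj₁ zero)        (inj₂ (inj₁ zero)) = T⇒true≡ x~y
    f-adj (inj₁ zero)        (inj₂ (inj₂ i))    = T⇒true≡ (x~t i)
    f-adj (inj₂ (inj₁ zero)) (inj₁ zero)        = T⇒true≡ (Adj-sym G x~y)
    f-adj (inj₂ (inj₁ zero)) (inj₂ (inj₁ zero)) = trans (adj-irrefl J _) (sym (adj-irrefl G y))
    f-adj (inj₂ (inj₁ zero)) (inj₂ (inj₂ i))    = yt i
    f-adj (inj₂ (inj₂ i))    (inj₁ zero)        = T⇒true≡ (Adj-sym G (x~t i))
    f-adj (inj₂ (inj₂ i))    (inj₂ (inj₁ zero)) =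
      trans (adj-sym J _ _) (trans (yt i) (adj-sym G _ _))
    f-adj (inj₂ (inj₂ i))    (inj₂ (inj₂ j))    = tt i j

-- Claw-freeness

record IndependentTriple (G : Graph V) (a b c : V) : Set where
  constructor triple
  field
    a≢b : a ≢ b
    a≢c : a ≢ c
    b≢c : b ≢ c
    a≁b : ¬ Adj G a b
    a≁c : ¬ Adj G a c
    b≁c : ¬ Adj G b c

ClawFree : Graph V → Set
ClawFree G = ∀ {x a b c} → Adj G x a → Adj G x b → Adj G x c → ¬ IndependentTriple G a b c

module _ (G : Graph (Fin n)) (G-locallyConnected : LocallyConnected G)
  (no-K₁,₁,₃ : ¬ (K₁,₁,₃ InducedSubgraphOf G))
  (no-K₁+K₁∪P₃ : ¬ ((K 1 + (K 1 ∪ P 3)) InducedSubgraphOf G)) where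

  private
    no-neighborhood-claw : ∀ {x v a b c} → Adj G x v → Adj G x a → Adj G x b → Adj G x c →
      Adj G v a → Adj G v b → Adj G v c → ¬ IndependentTriple G a b c
    no-neighborhood-claw {x} {v} x~v x~a x~b x~c v~a v~b v~c (triple a≢b a≢c b≢c a≁b a≁c b≁c) =
      no-K₁,₁,₃ (cone-induced G (K 1 + complement (K 3)) x~v
        (three-all (Adj G x) x~a x~b x~c)
        (three-all (v ≢_) (Adj⇒≢ G v~a) (Adj⇒≢ G v~b) (Adj⇒≢ G v~c))
        (three-injective a≢b a≢c b≢c)
        (three-all (λ u → true ≡ adj G v u) (T⇒true≡ v~a) (T⇒true≡ v~b) (T⇒true≡ v~c))
        (three-adj (complement (K 3)) G
          (¬T⇒false≡ a≁b) (¬T⇒false≡ a≁c) (¬T⇒false≡ b≁c)))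

    no-neighborhood-P₃∪K₁ : ∀ {x c p q b} → Adj G x c → Adj G x p → Adj G x q → Adj G x b →
      Adj G p q → Adj G q b → ¬ Adj G q c → ¬ IndependentTriple G p b c
    no-neighborhood-P₃∪K₁ {x} {c} {q = q} x~c x~p x~q x~b p~q q~b q≁c
      (triple p≢b p≢c b≢c p≁b p≁c b≁c) =
      no-K₁+K₁∪P₃ (cone-induced G (K 1 ∪ P 3) x~c
        (three-all (Adj G x) x~p x~q x~b)
        (three-all (c ≢_) (p≢c ∘ sym) c≢q (b≢c ∘ sym))
        (three-injective (Adj⇒≢ G p~q) p≢b (Adj⇒≢ G q~b))
        (three-all (λ u → false ≡ adj G c u)
          (¬T⇒false≡ (p≁c ∘ Adj-sym G)) (¬T⇒false≡ (q≁c ∘ Adj-sym G))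
          (¬T⇒false≡ (b≁c ∘ Adj-sym G)))
        (three-adj (P 3) G (T⇒true≡ p~q) (¬T⇒false≡ p≁b) (T⇒true≡ q~b)))
      where
      c≢q : c ≢ q
      c≢q refl = p≁c p~q

    -- If `q` met both `b` and `c`, then `x` and `q` would be the two centers of a `K₁,₁,₃` over the
    -- triple. If it met just one, `p`, `q` and that one would form the `P 3`, and the other vertex
    -- the isolated `K 1`, below the apex `x`.
    move : ∀ {x p q b c} → Adj G x p → Adj G x q → Adj G x b → Adj G x c → Adj G p q →
      IndependentTriple G p b c → IndependentTriple G q b c
    move {q = q} {b} {c} x~p x~q x~b x~c p~q t@(triple p≢b p≢c b≢c p≁b p≁c b≁c)
      with T? (adj G q b) | T? (adj G q c)
    ... | yes q~b | yes q~c =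
      ⊥-elim (no-neighborhood-claw x~q x~p x~b x~c (Adj-sym G p~q) q~b q~c t)
    ... | yes q~b | no q≁c =
      ⊥-elim (no-neighborhood-P₃∪K₁ x~c x~p x~q x~b p~q q~b q≁c t)
    ... | no q≁b | yes q~c =
      ⊥-elim (no-neighborhood-P₃∪K₁ x~b x~p x~q x~c p~q q~c q≁b
        (triple p≢c p≢b (b≢c ∘ sym) p≁c p≁b (b≁c ∘ Adj-sym G)))
    ... | no q≁b | no q≁c =
      triple (λ { refl → p≁b p~q }) (λ { refl → p≁c p~q }) b≢c q≁b q≁c b≁c

    -- The triple survives each step with `b` and `c` fixed, until its first vertex is `b` itself.
    walk-contradiction : ∀ {x b c p} {x~p : Adj G x p} {x~b : Adj G x b} → Adj G x c →
      Star (Adj (G [ neighborhood G x ])) (p , x~p) (b , x~b) → ¬ IndependentTriple G p b c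
    walk-contradiction x~c ε t = IndependentTriple.a≢b t refl
    walk-contradiction {x~p = x~p} {x~b} x~c (_◅_ {j = q , x~q} p~q walk) t =
      walk-contradiction x~c walk (move x~p x~q x~b x~c p~q t)

  claw-free : ClawFree G
  claw-free x~a x~b x~c = walk-contradiction x~c (G-locallyConnected _ (_ , x~a) (_ , x~b))

-- Paths

-- `Path G a L b`: the vertex list L of a walk from a to b in G, both ends included.
data Path (G : Graph V) : V → List V → V → Set where
  single : ∀ v → Path G v (v ∷ []) v
  _∷_    : ∀ {u v w L} → Adj G u v → Path G v L w → Path G u (u ∷ L) w

infixr 5 _∷_

-- A `Path` is never empty, so whether anything precedes or follows `z` becomes a case distinction.
data Split (G : Graph V) (z : V) : V → List V → V → Set where
  only   : Split G z z (z ∷ []) z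
  first  : ∀ {c B b} → Adj G z c → Path G c B b → Split G z z (z ∷ B) b
  last   : ∀ {a A c} → Path G a A c → Adj G c z → Split G z a (A ∷ʳ z) z
  middle : ∀ {a A c d B b} → Path G a A c → Adj G c z → Adj G z d → Path G d B b →
           Split G z a (A ++ z ∷ B) b

module _ {G : Graph V} where

  path-++ : ∀ {a b c d L M} → Path G a L b → Adj G b c → Path G c M d → Path G a (L ++ M) d
  path-++ (single _)   b~c q = b~c ∷ q
  path-++ (e ∷ p) b~c q = e ∷ path-++ p b~c q

  path-reverse : ∀ {a b L} → Path G a L b → Path G b (reverse L) a
  path-reverse (single v) = single v
  path-reverse (_∷_ {u} {L = L} e p) =
    subst (λ M → Path G _ M u) (sym (unfold-reverse u L))
      (path-++ (path-reverse p) (Adj-sym G e) (single u))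

  first∈ : ∀ {a b L} → Path G a L b → a ∈ L
  first∈ (single _)   = here refl
  first∈ (_ ∷ _) = here refl

  last∈ : ∀ {a b L} → Path G a L b → b ∈ L
  last∈ (single _)   = here refl
  last∈ (_ ∷ p) = there (last∈ p)

  path-second : ∀ {a b c d L M} → Path G a L b → Adj G b c → Path G c M d →
    ∃[ e ] ∃[ N ] Adj G a e × Path G e N d × L ++ M ≡ a ∷ N
  path-second (single _)   b~c q = _ , _ , b~c , q , refl
  path-second (e ∷ p) b~c q = _ , _ , e , path-++ p b~c q , refl

  split : ∀ {a b L z} → Path G a L b → z ∈ L → Split G z a L b
  split (single _)   (here refl) = only
  split (e ∷ p) (here refl) = first e p
  split (e ∷ p) (there z∈) with split p z∈
  ... | only           = last (single _) e
  ... | first f q      = middle (single _) e f q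
  ... | last q f       = last (e ∷ q) f
  ... | middle q f g r = middle (e ∷ q) f g r

  -- The vertex `w` ends one path and starts the other, and `D` may be empty; this is the form in
  -- which `sweep` advances `w`.
  cut : ∀ {a b L w} → Path G a L b → w ∈ L →
    ∃[ D ] ∃[ W ] L ≡ D ++ W × Path G a (D ∷ʳ w) w × Path G w W b
  cut p w∈ with split p w∈
  ... | only           = [] , _ , refl , (single _) , (single _)
  ... | first e q      = [] , _ , refl , (single _) , e ∷ q
  ... | last q e       = _ , _ , refl , path-++ q e (single _) , (single _)
  ... | middle q e f r = _ , _ , refl , path-++ q e (single _) , f ∷ r

  path⇒linked : ∀ {a b c L} → Path G a L b → Adj G b c → Linked (Adj G) (L ∷ʳ c)
  path⇒linked (single _)           b~c = b~c ∷ [-]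
  path⇒linked (e ∷ p@(single _)) b~c = e ∷ path⇒linked p b~c
  path⇒linked (e ∷ p@(_ ∷ _)) b~c = e ∷ path⇒linked p b~c

  linked⇒path : ∀ {a c} L → Linked (Adj G) (a ∷ L ∷ʳ c) →
    ∃[ b ] Path G a (a ∷ L) b × Adj G b c
  linked⇒path []      (e ∷ _) = _ , (single _) , e
  linked⇒path (_ ∷ L) (e ∷ l) with linked⇒path L l
  ... | b , p , b~c = b , e ∷ p , b~c

  path⇒cycle : ∀ {a b L} → Path G a L b → Adj G b a → Unique L → 3 ≤ length L →
    Σ (Cycle G) λ C → vertices C ≡ L
  -- The clauses agree; matching on the path only exposes `L` as a cons, to be read as `start` and
  -- `rest`.
  path⇒cycle p@(single _) b~a distinct length≥3 =
    record { distinct = distinct ; length≥3 = length≥3 ; closed = path⇒linked p b~a } , refl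
  path⇒cycle p@(_ ∷ _) b~a distinct length≥3 =
    record { distinct = distinct ; length≥3 = length≥3 ; closed = path⇒linked p b~a } , refl

module _ {A : Set} where

  Unique-↭ : {xs ys : List A} → xs ↭ ys → Unique xs → Unique ys
  Unique-↭ p = Unique-resp-↭ (setoid A) (↭⇒↭ₛ p)

  Unique-++⇒≢ : ∀ xs {ys : List A} {u v} → Unique (xs ++ ys) → u ∈ xs → v ∈ ys → u ≢ v
  Unique-++⇒≢ (_ ∷ xs) (x# ∷ _) (here refl) v∈ = All.lookup x# (∈-++⁺ʳ xs v∈)
  Unique-++⇒≢ (_ ∷ xs) (_ ∷ un) (there u∈)  v∈ = Unique-++⇒≢ xs un u∈ v∈

-- Extending a cycle of a claw-free graph

module _ {n : ℕ} (G : Graph (Fin n)) (G-clawFree : ClawFree G) (C : Cycle G) where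

  open CommutativeMonoidSolver (++-commutativeMonoid {A = Fin n}) using (solve; _⊜_; _⊕_)
  open DecMembership (_≟_ {n}) using (_∈?_)

  private
    _~_ : Fin n → Fin n → Set
    _~_ = Adj G

    flip : ∀ {u v} → u ~ v → v ~ u
    flip = Adj-sym G

    E : Set
    E = Extendable C

    -- "not adjacent and distinct", with E in place of ⊥ because E is not
    -- assumed to be stable under double negation.
    _#_ : Fin n → Fin n → Set
    u # v = u ≡ v ⊎ u ~ v → E

    #-sym : ∀ {u v} → u # v → v # u
    #-sym u#v (inj₁ e) = u#v (inj₁ (sym e))
    #-sym u#v (inj₂ e) = u#v (inj₂ (flip e))

    -- Claw-freeness with goal `E`. Usually two pairs are excluded already, and the third argument
    -- is a continuation that receives the edge forced between the remaining pair.
    no-claw : ∀ {v p q r} → v ~ p → v ~ q → v ~ r → p # q → p # r → q # r → E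
    no-claw {p = p} {q} {r} v~p v~q v~r p#q p#r q#r
      with p ≟ q | p ≟ r | q ≟ r | T? (adj G p q) | T? (adj G p r) | T? (adj G q r)
    ... | yes e | _ | _ | _ | _ | _ = p#q (inj₁ e)
    ... | _ | yes e | _ | _ | _ | _ = p#r (inj₁ e)
    ... | _ | _ | yes e | _ | _ | _ = q#r (inj₁ e)
    ... | _ | _ | _ | yes e | _ | _ = p#q (inj₂ e)
    ... | _ | _ | _ | _ | yes e | _ = p#r (inj₂ e)
    ... | _ | _ | _ | _ | _ | yes e = q#r (inj₂ e)
    ... | no p≢q | no p≢r | no q≢r | no p≁q | no p≁r | no q≁r =
      ⊥-elim (G-clawFree v~p v~q v~r (triple p≢q p≢r q≢r p≁q p≁r q≁r))

    distinct-parts : ∀ M {N u v} → M ++ N ↭ vertices C → u ∈ M → v ∈ N → u ≢ v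
    distinct-parts M perm = Unique-++⇒≢ M (Unique-↭ (↭-sym perm) (Cycle.distinct C))

    -- Distinctness, order and containment all pass along the permutation, so each extension below
    -- needs only a closed path and a rearrangement of its vertices.
    extend : ∀ {y a b L} → y ∉ vertices C → Path G a L b → b ~ a → L ↭ y ∷ vertices C → E
    extend {y} y∉C p b~a perm with path⇒cycle p b~a
      (Unique-↭ (↭-sym perm) (All.tabulate (λ v∈C → λ { refl → y∉C v∈C }) ∷ Cycle.distinct C))
      (subst (3 ≤_) (sym (↭-length perm)) (m≤n⇒m≤1+n (Cycle.length≥3 C)))
    ... | C′ , refl = C′ , ↭-length perm , ∈-resp-↭ (↭-sym perm) ∘ there

    -- Extendability of C depends only on its vertex set, so any cycle through the
    -- same vertices will do.
    record Opening (x : Fin n) : Set where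
      constructor opening
      field
        {a b} : Fin n
        {L}   : List (Fin n)
        x~a   : x ~ a
        path  : Path G a L b
        b~x   : b ~ x
        perm  : x ∷ L ↭ vertices C

    open-at : ∀ {x} → x ∈ vertices C → Opening x
    open-at x∈C with linked⇒path (Cycle.rest C) (Cycle.closed C)
    ... | e , p , e~s = go p x∈C e~s ↭-refl
      where
      go : ∀ {x s e L} → Path G s L e → x ∈ L → e ~ s → L ↭ vertices C → Opening x
      go p x∈ e~s perm with split p x∈
      ... | only           = ⊥-elim (Adj⇒≢ G e~s refl)
      ... | first e q      = opening e q e~s perm
      ... | last q e       = opening e~s q e (↭-trans (∷↭∷ʳ _ _) perm)
      ... | middle {A = A} {B = B} q e f r =
        opening f (path-++ r e~s q) e (↭-trans (++-comm (_ ∷ B) A) perm)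

    reverse-opening : ∀ {x} → Opening x → Opening x
    reverse-opening (opening {L = L} x~a p b~x perm) =
      opening (flip b~x) (path-reverse p) (flip x~a) (↭-trans (prep _ (↭-reverse L)) perm)

    module _ {y : Fin n} (y∉C : y ∉ vertices C) where

      insert : ∀ {x} (o : Opening x) → x ~ y → y ~ Opening.a o → E
      insert (opening x~a p b~x perm) x~y y~a =
        extend y∉C (x~y ∷ y~a ∷ p) b~x (↭-trans (swap _ _ ↭-refl) (prep y perm))

      -- The cycle x A z B with the ear x y z; x and z need not be adjacent.
      record Ear (x z : Fin n) : Set where
        constructor ear
        field
          {a a′ b b′} : Fin n
          {A B}       : List (Fin n)
          x~y         : x ~ y
          z~y         : z ~ y
          x~a         : x ~ a
          pathA       : Path G a A a′
          a′~z        : a′ ~ z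
          z~b         : z ~ b
          pathB       : Path G b B b′
          b′~x        : b′ ~ x
          perm        : x ∷ A ++ z ∷ B ↭ vertices C

      -- Exchanging `x` and `z` here and reversing the cycle in `reflect` carry statements about `a`
      -- over to all four of `a`, `a′`, `b`, `b′`.
      rotate : ∀ {x z} → Ear x z → Ear z x
      rotate {x} {z} (ear {A = A} {B} x~y z~y x~a p a′~z z~b q b′~x perm) =
        ear z~y x~y z~b q b′~x x~a p a′~z (↭-trans (++-comm (z ∷ B) (x ∷ A)) perm)

      reflect : ∀ {x z} → Ear x z → Ear x z
      reflect {x} {z} (ear {A = A} {B} x~y z~y x~a p a′~z z~b q b′~x perm) =
        ear x~y z~y (flip b′~x) (path-reverse q) (flip z~b) (flip a′~z) (path-reverse p) (flip x~a)
          (↭-trans (prep x (↭-trans (++⁺ (↭-reverse B) (prep z (↭-reverse A)))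
            (solve 3 (λ A z B → B ⊕ z ⊕ A ⊜ A ⊕ z ⊕ B) ↭-refl A (z ∷ []) B))) perm)

      ear-opening : ∀ {x z} → Ear x z → Opening x
      ear-opening (ear _ _ x~a p a′~z z~b q b′~x perm) =
        opening x~a (path-++ p a′~z (z~b ∷ q)) b′~x perm

      y# : ∀ {v} → v ∈ vertices C → (y ~ v → E) → y # v
      y# v∈C y~v⇒E = [ (λ { refl → ⊥-elim (y∉C v∈C) }) , y~v⇒E ]′

      module _ {x z} (c : Ear x z) where
        open Ear c

        a∈C : a ∈ vertices C
        a∈C = ∈-resp-↭ perm (there (∈-++⁺ˡ (first∈ pathA)))

        y#a : y # a
        y#a = y# a∈C (insert (ear-opening c) x~y)

      module _ {x z} (c : Ear x z) where
        open Ear c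

        -- Among the neighbors `y`, `a′`, `b` of `z`, an edge from `y` would allow inserting `y`
        -- next to `z`. What remains is a chord from `a′` to `b`, along which the cycle can skip
        -- `z`.
        bypass-z : (a′ ~ b → E) → E
        bypass-z a′~b⇒E = no-claw z~y (flip a′~z) z~b
          (y#a (reflect (rotate c)))
          (y#a (rotate c))
          [ ⊥-elim ∘ distinct-parts (x ∷ A) perm (there (last∈ pathA)) (there (first∈ pathB)) , a′~b⇒E ]′

        -- The new cycle is `x y z A B`: `z` moves in front of `a`, and the chord from `a′` to `b`
        -- closes the gap.
        z~a⇒E : z ~ a → E
        z~a⇒E z~a = bypass-z λ a′~b →
          extend y∉C (x~y ∷ flip z~y ∷ z~a ∷ path-++ pathA a′~b pathB) b′~x
            (↭-trans
              (solve 5 (λ x y z A B → x ⊕ y ⊕ z ⊕ A ⊕ B ⊜ y ⊕ x ⊕ A ⊕ z ⊕ B)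
                ↭-refl (x ∷ []) (y ∷ []) (z ∷ []) A B)
              (prep y perm))

      -- The new cycle runs `x y z w`, back along `D` to `p`, then from `w′` along `D′` to `q` and
      -- `x`.
      cross : ∀ {x z p w w′ q D D′} → x ~ y → z ~ y → Path G p D w → Path G w′ D′ q → q ~ x →
        z ~ w → p ~ w′ → x ∷ z ∷ D ++ D′ ↭ vertices C → E
      cross {x} {z} {D = D} {D′} x~y z~y p q q~x z~w p~w′ perm =
        extend y∉C (x~y ∷ flip z~y ∷ z~w ∷ path-++ (path-reverse p) p~w′ q) q~x
          (↭-trans (swap x y (prep z (++⁺ʳ D′ (↭-reverse D)))) (prep y perm))

      module Sweep {x z} (c : Ear x z) where
        open Ear c

        -- D is the part of A before w.
        sweep : ∀ D {w W} → Path G a (D ∷ʳ w) w → Path G w W a′ → A ≡ D ++ W →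
          x ~ w → z ~ w → y # w → E
        -- Now `w` is `a′`, so `x` is adjacent to a cycle neighbor of `z`.
        sweep D p (single _) A≡ x~w z~w y#w = z~a⇒E (reflect (rotate c)) x~w
        sweep D {w} p (_∷_ {v = w⁺} {L = W} w~w⁺ q) A≡ x~w z~w y#w =
          -- The first two claws, centered at `x` and `z`, force `w ~ a` and `w ~ b`. The next two,
          -- both centered at `w`, then force `z ~ w⁺` and `x ~ w⁺`.
          no-claw x~y x~w x~a y#w (y#a c) [ (λ { refl → z~a⇒E c z~w }) , (λ w~a →
          no-claw z~y z~w z~b y#w (y#a (rotate c))
            [ (λ { refl → z~a⇒E (rotate c) x~w }) , (λ w~b →
          no-claw w~a (flip z~w) w~w⁺ a#z a#w⁺
            [ (λ { refl → y#w⁺ (inj₂ (flip z~y)) }) , (λ z~w⁺ →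
          no-claw w~b (flip x~w) w~w⁺ b#x b#w⁺
            [ (λ { refl → y#w⁺ (inj₂ (flip x~y)) }) , (λ x~w⁺ →
          sweep (D ∷ʳ w) (path-++ p w~w⁺ (single _)) q A≡′ x~w⁺ z~w⁺ y#w⁺) ]′) ]′) ]′) ]′
          where
          A≡′ : A ≡ (D ∷ʳ w) ++ W
          A≡′ = trans A≡ (sym (++-assoc D (w ∷ []) W))

          perm′ : x ∷ ((D ∷ʳ w) ++ W) ++ z ∷ B ↭ vertices C
          perm′ = subst (λ A → x ∷ A ++ z ∷ B ↭ vertices C) A≡′ perm

          w⁺∈A : w⁺ ∈ A
          w⁺∈A = subst (w⁺ ∈_) (sym A≡′) (∈-++⁺ʳ (D ∷ʳ w) (first∈ q))

          w⁺∈C : w⁺ ∈ vertices C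
          w⁺∈C = ∈-resp-↭ perm (there (∈-++⁺ˡ w⁺∈A))

          y#w⁺ : y # w⁺
          -- If `y ~ w⁺`, then `x y w⁺` is an ear, and `x` is adjacent to the predecessor `w` of
          -- `w⁺`. The successor of `w⁺` is `z` when `w⁺` is the end of `A`, hence `path-second`.
          y#w⁺ = y# w⁺∈C λ y~w⁺ → ear-at-w⁺ y~w⁺ (path-second q a′~z (z~b ∷ pathB))
            where
            ear-at-w⁺ : y ~ w⁺ →
              ∃[ e ] ∃[ N ] w⁺ ~ e × Path G e N b′ × W ++ z ∷ B ≡ w⁺ ∷ N → E
            ear-at-w⁺ y~w⁺ (_ , _ , w⁺~e , r , eq) = z~a⇒E
              (reflect (rotate (ear x~y (flip y~w⁺) x~a p w~w⁺ w⁺~e r b′~x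
                (↭-trans (prep x (↭-trans
                  (↭-reflexive (cong ((D ∷ʳ w) ++_) (sym eq)))
                  (↭-reflexive (sym (++-assoc (D ∷ʳ w) W (z ∷ B)))))) perm′))))
              x~w

          a#z : a # z
          a#z = #-sym [ (λ { refl → y#a c (inj₂ (flip z~y)) }) , z~a⇒E c ]′

          b#x : b # x
          b#x = #-sym [ (λ { refl → y#a (rotate c) (inj₂ (flip x~y)) }) , z~a⇒E (rotate c) ]′

          a#w⁺ : a # w⁺
          a#w⁺ = [ ⊥-elim ∘ distinct-parts (x ∷ D ∷ʳ w)
                     (↭-trans (↭-reflexive (sym (++-assoc (x ∷ D ∷ʳ w) W (z ∷ B)))) perm′)
                     (there (first∈ p)) (∈-++⁺ˡ (first∈ q))
                 -- The new cycle is `x y z w … a w⁺ … a′ b … b′`.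
                 , (λ a~w⁺ → bypass-z c λ a′~b →
                     cross x~y z~y p (path-++ q a′~b pathB) b′~x z~w a~w⁺
                       (↭-trans
                         (solve 5
                           (λ x z D W B → x ⊕ z ⊕ D ⊕ W ⊕ B ⊜ x ⊕ (D ⊕ W) ⊕ z ⊕ B)
                           ↭-refl (x ∷ []) (z ∷ []) (D ∷ʳ w) W B)
                         perm′)) ]′

          b#w⁺ : b # w⁺
          b#w⁺ = [ (λ { refl → ⊥-elim (distinct-parts (x ∷ A) perm
                     (there w⁺∈A) (there (first∈ pathB)) refl) })
                 -- The new cycle is `z y x w … a b′ … b w⁺ … a′`, with `x` skipped along the chord
                 -- from `b′` to `a`.
                 , (λ b~w⁺ → bypass-z (rotate c) λ b′~a →
                     cross z~y x~y (path-++ pathB b′~a p) q a′~z x~w b~w⁺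
                       (↭-trans
                         (solve 5
                           (λ x z D W B → z ⊕ x ⊕ (B ⊕ D) ⊕ W ⊜ x ⊕ (D ⊕ W) ⊕ z ⊕ B)
                           ↭-refl (x ∷ []) (z ∷ []) (D ∷ʳ w) W B)
                         perm′)) ]′

        sweep-from : ∀ {w} → w ∈ A → x ~ w → z ~ w → y # w → E
        sweep-from w∈A with cut pathA w∈A
        ... | D , _ , A≡ , p , q = sweep D p q A≡

      common-neighbor⇒E : ∀ {x z w} → Ear x z → w ∈ vertices C → x ~ w → z ~ w → y # w → E
      common-neighbor⇒E c w∈C x~w z~w y#w with ∈-resp-↭ (↭-sym (Ear.perm c)) w∈C
      ... | here refl = ⊥-elim (Adj⇒≢ G x~w refl)
      ... | there w∈ with ∈-++⁻ (Ear.A c) w∈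
      ...   | inj₁ w∈A         = Sweep.sweep-from c w∈A x~w z~w y#w
      ...   | inj₂ (here refl) = ⊥-elim (Adj⇒≢ G z~w refl)
      ...   | inj₂ (there w∈B) = Sweep.sweep-from (rotate c) w∈B z~w x~w y#w

      -- If `z` is next to `x` on the cycle, `y` fits between them; otherwise both arcs have inner
      -- vertices, as `Ear` demands.
      ear-to : ∀ {x z} → Opening x → z ∈ vertices C → x ~ z → x ~ y → z ~ y → (Ear x z → E) → E
      ear-to o@(opening x~a p b~x perm) z∈C x~z x~y z~y k with ∈-resp-↭ (↭-sym perm) z∈C
      ... | here refl = ⊥-elim (Adj⇒≢ G x~z refl)
      ... | there z∈L with split p z∈L
      ...   | only           = insert o x~y (flip z~y)
      ...   | first _ _      = insert o x~y (flip z~y)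
      ...   | last _ _       = insert (reverse-opening o) x~y (flip z~y)
      ...   | middle q e f r = k (ear x~y z~y x~a q e f r b~x perm)

    -- The invariant of the walk in the neighborhood of `x`. At the successor of `x`, which is on
    -- the cycle, it provides a vertex to insert.
    Near : Fin n → Fin n → Set
    Near x p = p ∉ vertices C ⊎ (p ∈ vertices C × ∃[ y ] y ∉ vertices C × x ~ y × p ~ y)

    walk⇒E : ∀ {x p} (o : Opening x) {x~p : x ~ p} →
      Star (Adj (G [ neighborhood G x ])) (p , x~p) (Opening.a o , Opening.x~a o) → Near x p → E
    walk⇒E o ε (inj₁ a∉C) =
      ⊥-elim (a∉C (∈-resp-↭ (Opening.perm o) (there (first∈ (Opening.path o)))))
    walk⇒E o ε (inj₂ (_ , y , y∉C , x~y , a~y)) = insert y∉C o x~y (flip a~y)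
    walk⇒E o {x~p} (_◅_ {j = q , x~q} p~q walk) near with q ∈? vertices C
    ... | no q∉C = walk⇒E o walk (inj₁ q∉C)
    ... | yes q∈C with near
    -- The vertex `p` itself is the common neighbor of `x` and `q` off the cycle.
    ...   | inj₁ p∉C = walk⇒E o walk (inj₂ (q∈C , _ , p∉C , x~p , flip p~q))
    ...   | inj₂ (p∈C , y , y∉C , x~y , p~y) with T? (adj G q y)
    ...     | yes q~y = walk⇒E o walk (inj₂ (q∈C , y , y∉C , x~y , q~y))
    -- The ear joins `x` and `p` through `y`, and `q` is the common neighbor from which the sweep
    -- starts.
    ...     | no q≁y = ear-to y∉C o p∈C x~p x~y p~y λ c →
      common-neighbor⇒E y∉C c q∈C x~q p~q (y# y∉C q∈C (⊥-elim ∘ q≁y ∘ flip))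

  boundary-edge⇒extendable : LocallyConnected G → ∀ {x y} →
    x ∈ vertices C → y ∉ vertices C → Adj G x y → Extendable C
  boundary-edge⇒extendable locallyConnected x∈C y∉C x~y =
    walk⇒E o (locallyConnected _ (_ , x~y) (_ , Opening.x~a o)) (inj₁ y∉C)
    where o = open-at x∈C

-- Connectedness

-- If `L` held every vertex, positions in `L` would inject `Fin n` into `Fin (length L)`.
missing-vertex : (L : List (Fin n)) → length L < n → ∃[ v ] v ∉ L
missing-vertex {n} L L<n = ¬∀⟶∃¬ n (_∈ L) (_∈? L) λ all∈L →
  <⇒≱ L<n (injective⇒≤ {f = index ∘ all∈L}
    (index-injective (setoid (Fin n)) (all∈L _) (all∈L _)))
  where open DecMembership (_≟_ {n}) using (_∈?_)

module _ {n : ℕ} (G : Graph (Fin n)) (G-connected : Connected G) where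

  open DecMembership (_≟_ {n}) using (_∈?_)

  boundary-edge : ∀ {s} (L : List (Fin n)) → s ∈ L → length L < n →
    ∃[ p ] ∃[ q ] p ∈ L × q ∉ L × Adj G p q
  boundary-edge {s} L s∈L L<n with missing-vertex L L<n
  ... | v , v∉L = go (G-connected s v) s∈L v∉L
    where
    go : ∀ {s v} → Star (Adj G) s v → s ∈ L → v ∉ L → ∃[ p ] ∃[ q ] p ∈ L × q ∉ L × Adj G p q
    go ε s∈L v∉L = ⊥-elim (v∉L s∈L)
    go (_◅_ {j = q} s~q walk) s∈L v∉L with q ∈? L
    ... | yes q∈L = go walk q∈L v∉L
    ... | no q∉L  = _ , _ , s∈L , q∉L , s~q

-- Triangles and the conclusion

triangle : (G : Graph V) {u v w : V} → Adj G u v → Adj G v w → Adj G w u → OnTriangle G u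
triangle G u~v v~w w~u = record
  { distinct = (Adj⇒≢ G u~v ∷ Adj⇒≢ G w~u ∘ sym ∷ []) ∷ (Adj⇒≢ G v~w ∷ []) ∷ [] ∷ []
  ; length≥3 = ≤-refl
  ; closed   = u~v ∷ v~w ∷ w~u ∷ [-]
  } , refl , here refl

first-step : (G : Graph V) {x p q : V} {x~p : Adj G x p} {x~q : Adj G x q} →
  Star (Adj (G [ neighborhood G x ])) (p , x~p) (q , x~q) → p ≢ q → ∃[ r ] Adj G x r × Adj G p r
first-step G ε                           p≢q = ⊥-elim (p≢q refl)
first-step G (_◅_ {j = r , x~r} p~r _) _ = r , x~r , p~r

-- Take an edge `u v` and a third vertex `q` adjacent to one of its ends. The neighborhood of that
-- end contains a walk from the other end to `q`, whose first step reaches a common neighbor of `u`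
-- and `v`.
on-triangle : (G : Graph (Fin n)) → Connected G → LocallyConnected G → 3 ≤ n → ∀ u → OnTriangle G u
on-triangle G connected locallyConnected 3≤n u
  with boundary-edge G connected (u ∷ []) (here refl) (≤-trans (s≤s (s≤s z≤n)) 3≤n)
... | _ , v , here refl , _ , u~v
  with boundary-edge G connected (u ∷ v ∷ []) (here refl) 3≤n
... | _ , q , here refl , q∉ , u~q
  with first-step G (locallyConnected u (v , u~v) (q , u~q)) (λ { refl → q∉ (there (here refl)) })
... | r , u~r , v~r = triangle G u~v v~r (Adj-sym G u~r)
on-triangle G connected locallyConnected 3≤n u
    | _ , v , here refl , _ , u~v
    | _ , q , there (here refl) , q∉ , v~q
  with first-step G (locallyConnected v (u , Adj-sym G u~v) (q , v~q)) (λ { refl → q∉ (here refl) })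
... | r , v~r , u~r = triangle G u~v v~r (Adj-sym G u~r)

theorem7 : ∀ {n : ℕ} (G : Graph (Fin n)) →
    Connected G →
    LocallyConnected G →
    ((_ , K₁,₁,₃) ∷ (_ , (K 1 + (K 1 ∪ P 3))) ∷ []) -Free G →
    3 ≤ order G →
    FullyCycleExtendable G
theorem7 G connected locallyConnected (no-K₁,₁,₃ ∷ no-K₁+K₁∪P₃ ∷ []) 3≤n =
  on-triangle G connected locallyConnected 3≤n ,
  λ C C<n → let _ , _ , x∈C , y∉C , x~y = boundary-edge G connected (vertices C) (here refl) C<n in
    boundary-edge⇒extendable G
      (claw-free G locallyConnected no-K₁,₁,₃ no-K₁+K₁∪P₃) C locallyConnected x∈C y∉C x~y
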